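{- For every $\varepsilon>0$ there exists a $\delta>0$ such that there is no mapping $\psi$ from undirected unweighted graphs $G$ on $n$ nodes to bitstrings of length $O(n^{4/3-\varepsilon})$ such that the distances of $G$ can always be recovered from the bitstring $\psi(G)$ within $+n^{\delta}$ additive error (i.e., such that there is a decoding procedure which, given $\psi(G)$ and two nodes $u,v$, outputs a value $d$ with $\mathrm{dist}_G(u,v)\le d\le \mathrm{dist}_G(u,v)+n^{\delta}$).
   Context: $\mathrm{dist}_G(u,v)$ denotes the shortest-path distance between $u$ and $v$ in $G$. Graphs on $n$ nodes are considered on a fixed labeled node set of size $n$. -}

module Defs where

open import Data.Nat using (ℕ; zero; suc; _+_; _*_; _∸_; _^_; _≤_; _<_)
open import Data.Fin using (Fin)
open import Data.Bool using (Bool; true)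
open import Data.List using (List; length)
open import Data.Maybe using (Maybe; just; nothing)
open import Data.Product using (Σ; ∃; ∃-syntax; _×_)
open import Relation.Binary.PropositionalEquality using (_≡_)
open import Relation.Nullary using (¬_)

record Graph (n : ℕ) : Set where
  field
    adj   : Fin n → Fin n → Bool
    sym   : ∀ u v → adj u v ≡ adj v u
    irrefl : ∀ u → ¬ (adj u u ≡ true)
open Graph public

data Walk {n : ℕ} (G : Graph n) : Fin n → Fin n → ℕ → Set where
  here : ∀ {u} → Walk G u u 0
  step : ∀ {u w v k} → adj G u w ≡ true → Walk G w v k → Walk G u v (suc k)

IsDist : {n : ℕ} → Graph n → Fin n → Fin n → ℕ → Set
IsDist G u v k = Walk G u v k × (∀ m → Walk G u v m → k ≤ m)

Unreachable : {n : ℕ} → Graph n → Fin n → Fin n → Set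
Unreachable G u v = ¬ (∃[ k ] Walk G u v k)

-- Output o is a correct estimate of dist_G(u,v) within additive error n^(a/b):
--   dist ≤ d ≤ dist + n^(a/b), i.e. (d ∸ dist)^b ≤ n^a with dist ≤ d;
--   if dist = ∞ the output must be ∞ (nothing).
GoodEstimate : {n : ℕ} → (a b : ℕ) → Graph n → Fin n → Fin n → Maybe ℕ → Set
GoodEstimate {n} a b G u v (just d) =
  ∃[ k ] (IsDist G u v k × k ≤ d × (d ∸ k) ^ b ≤ n ^ a)
GoodEstimate a b G u v nothing = Unreachable G u v

-- There is an encoding ψ of n-node graphs into bitstrings of length
-- O(n^(4/3 - p/q)) from which all distances are recoverable within +n^(a/b).
-- Length bound L ≤ C·n^(4/3 - p/q)  ⟺  L^(3q) · n^(3p) ≤ C^(3q) · n^(4q).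
DistanceSketch : (p q a b : ℕ) → Set
DistanceSketch p q a b =
  ∃[ C ] ∃[ N₀ ]
  Σ (∀ n → Graph n → List Bool) λ ψ →
  Σ (∀ n → List Bool → Fin n → Fin n → Maybe ℕ) λ dec →
    (∀ n → N₀ ≤ n → (G : Graph n) →
       length (ψ n G) ^ (3 * q) * n ^ (3 * p) ≤ C ^ (3 * q) * n ^ (4 * q))
    × (∀ n (G : Graph n) (u v : Fin n) → GoodEstimate a b G u v (dec n (ψ n G) u v))

{-# OPTIONS --safe #-}

-- Let φ map s labels into {0, …, R ∸ 1} so that a sum of k values equals k φ(t) only if all
-- of them equal φ(t); Behrend's digit construction gives s = R^(1-o(1)) with k a small power
-- of R. In a layered outer graph with nodes (x , y), layers alternately add φ(v) to x and φ(w)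
-- to y. The path that uses v and w throughout is the only monotone path between its ends, and
-- the pair (v , w) at any of its nodes determines it. Subdivide every outer edge into a chain
-- of at least k edges and join incoming to outgoing edges at a node by a bipartite graph. For
-- every set of paths there is a graph in which exactly the unselected paths miss their
-- bipartite edges at the k even crossings. A walk between the ends of an unselected path needs
-- a backward step for each of them, or k backward steps to retrace a chain, so the distance
-- between the ends grows by 2k. Hence a decoder with error below 2k recovers the set: about
-- R^2 s^2 ≈ R^4 bits from a graph on n ≈ R^2 s ≈ R^3 nodes, that is n^(4/3 - o(1)) bits.
module Submission where

open import Defs hiding (sym)
open import Data.Bool using (Bool; true; false; _∨_; if_then_else_)
open import Data.Bool.Properties using (∨-comm) renaming (_≟_ to _≟ᵇ_)
open import Data.Fin using (Fin; toℕ; combine; remQuot; quotient; remainder; fromℕ<; finToFun; funToFin)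
open import Data.Fin.Properties using (toℕ-injective; toℕ<n; toℕ-fromℕ<; combine-remQuot; remQuot-combine; funToFin-finToFin; injective⇒≤) renaming (_≟_ to _≟ᶠ_)
open import Data.List using (List; []; _∷_; length; map)
open import Data.List.Properties using (length-map)
open import Data.List.Relation.Unary.All using (All; []; _∷_)
open import Data.Maybe using (Maybe; just; nothing)
open import Data.Nat using (ℕ; zero; suc; pred; _+_; _*_; _∸_; _^_; _≤_; _<_; z≤n; s≤s; NonZero; >-nonZero; >-nonZero⁻¹; ∣_-_∣)
open import Data.Nat.DivMod using (_%_; _mod_; m%n<n; [m+kn]%n≡m%n; m<n⇒m%n≡m)
open import Data.Nat.Properties
open import Data.Nat.Tactic.RingSolver using (solve-∀)
open import Data.Product using (∃-syntax; _×_; _,_; proj₁; proj₂)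
open import Data.Sum using (_⊎_; inj₁; inj₂)
open import Relation.Binary.PropositionalEquality using (_≡_; refl; sym; trans; cong; cong₂; subst; module ≡-Reasoning)
open import Relation.Nullary using (Dec; yes; no; ¬_; contradiction)
open import Relation.Nullary.Decidable using (isYes; _×-dec_; _⊎-dec_)

-- Behrend sets

private variable
  A A′ : Set

∑ : (A → ℕ) → List A → ℕ
∑ f []       = 0
∑ f (x ∷ xs) = f x + ∑ f xs

∑-map : ∀ (f : A′ → ℕ) (g : A → A′) l → ∑ f (map g l) ≡ ∑ (λ x → f (g x)) l
∑-map f g []      = refl
∑-map f g (x ∷ l) = cong (f (g x) +_) (∑-map f g l)

∑-+ : ∀ (f g : A → ℕ) l → ∑ (λ x → f x + g x) l ≡ ∑ f l + ∑ g l
∑-+ f g []      = refl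
∑-+ f g (x ∷ l) rewrite ∑-+ f g l = interchange (f x) (g x) (∑ f l) (∑ g l)
  where
  interchange : ∀ a b c d → a + b + (c + d) ≡ a + c + (b + d)
  interchange = solve-∀

∑-* : ∀ c (f : A → ℕ) l → ∑ (λ x → c * f x) l ≡ c * ∑ f l
∑-* c f []      = sym (*-zeroʳ c)
∑-* c f (x ∷ l) rewrite ∑-* c f l = sym (*-distribˡ-+ c (f x) (∑ f l))

∑-cong : ∀ {f g : A → ℕ} → (∀ x → f x ≡ g x) → ∀ l → ∑ f l ≡ ∑ g l
∑-cong f≗g []      = refl
∑-cong f≗g (x ∷ l) = cong₂ _+_ (f≗g x) (∑-cong f≗g l)

∑-const : ∀ c (l : List A) → ∑ (λ _ → c) l ≡ length l * c
∑-const c []      = refl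
∑-const c (x ∷ l) = cong (c +_) (∑-const c l)

∑-< : ∀ {b} {f : A → ℕ} → (∀ x → f x < b) → ∀ l → 0 < length l → ∑ f l < length l * b
∑-< f< (x ∷ l) _ = +-mono-<-≤ (f< x) (go l)
  where
  go : ∀ l → ∑ _ l ≤ length l * _
  go []      = z≤n
  go (y ∷ l) = +-mono-≤ (<⇒≤ (f< y)) (go l)

digits-unique : ∀ {B x x′ y y′} → x < B → x′ < B → x + B * y ≡ x′ + B * y′ → x ≡ x′ × y ≡ y′
digits-unique {B} {x} {x′} {y} {y′} x<B x′<B eq = x≡x′ , *-cancelˡ-≡ y y′ B (+-cancelˡ-≡ x _ _ (trans eq (cong (_+ B * y′) (sym x≡x′))))
  where
  instance
    B≢0 : NonZero B
    B≢0 = >-nonZero (≤-<-trans z≤n x<B)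
  low : ∀ x y → x < B → (x + B * y) % B ≡ x
  low x y x<B = trans (cong (λ z → (x + z) % B) (*-comm B y)) (trans ([m+kn]%n≡m%n x y B) (m<n⇒m%n≡m x<B))
  x≡x′ : x ≡ x′
  x≡x′ = trans (sym (low x y x<B)) (trans (cong (_% B) eq) (low x′ y′ x′<B))

digits-< : ∀ {B M x y} → x < B → y < M → x + B * y < B * M
digits-< {B} {M} {x} {y} x<B y<M = begin-strict
  x + B * y   <⟨ +-monoˡ-< (B * y) x<B ⟩
  B + B * y   ≡⟨ *-suc B y ⟨
  B * suc y   ≤⟨ *-monoʳ-≤ B y<M ⟩
  B * M       ∎
  where open ≤-Reasoning

remQuot-injective : ∀ {m} n {i j : Fin (m * n)} → quotient {m} n i ≡ quotient {m} n j → remainder {m} n i ≡ remainder {m} n j → i ≡ j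
remQuot-injective {m} n {i} {j} q r = trans (sym (combine-remQuot {m} n i)) (trans (cong₂ combine q r) (combine-remQuot {m} n j))

square-deviation : ∀ m n → m * m + n * n ≡ 2 * (n * m) + ∣ m - n ∣ * ∣ m - n ∣
square-deviation zero    zero    = refl
square-deviation (suc m) zero    = +-identityʳ _
square-deviation zero    (suc n) = sym (cong (λ z → 2 * z + suc n * suc n) (*-zeroʳ (suc n)))
square-deviation (suc m) (suc n) = trans (shiftˡ m n) (trans (cong (2 * m + 2 * n + 2 +_) (square-deviation m n)) (shiftʳ m n (∣ m - n ∣ * ∣ m - n ∣)))
  where
  shiftˡ : ∀ m n → suc m * suc m + suc n * suc n ≡ 2 * m + 2 * n + 2 + (m * m + n * n)
  shiftˡ = solve-∀
  shiftʳ : ∀ m n d → 2 * m + 2 * n + 2 + (2 * (n * m) + d) ≡ 2 * (suc n * suc m) + d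
  shiftʳ = solve-∀

-- The variance identity, with the same multiple of `m * m` added to both sides to avoid
-- subtraction. It says that the sum of squares is minimal only when all values equal their mean.
∑-square-deviation : ∀ (f : A → ℕ) m l → ∑ f l ≡ length l * m →
  ∑ (λ x → f x * f x) l ≡ length l * (m * m) + ∑ (λ x → ∣ f x - m ∣ * ∣ f x - m ∣) l
∑-square-deviation f m l eq = +-cancelʳ-≡ (length l * (m * m)) _ _ (begin
  ∑ (λ x → f x * f x) l + length l * (m * m)         ≡⟨ cong (∑ (λ x → f x * f x) l +_) (∑-const (m * m) l) ⟨
  ∑ (λ x → f x * f x) l + ∑ (λ _ → m * m) l          ≡⟨ ∑-+ (λ x → f x * f x) (λ _ → m * m) l ⟨
  ∑ (λ x → f x * f x + m * m) l                      ≡⟨ ∑-cong (λ x → square-deviation (f x) m) l ⟩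
  ∑ (λ x → 2 * (m * f x) + dev x) l                  ≡⟨ ∑-+ (λ x → 2 * (m * f x)) dev l ⟩
  ∑ (λ x → 2 * (m * f x)) l + ∑ dev l                ≡⟨ cong (_+ ∑ dev l) (trans (∑-* 2 (λ x → m * f x) l) (cong (2 *_) (trans (∑-* m f l) (cong (m *_) eq)))) ⟩
  2 * (m * (length l * m)) + ∑ dev l                 ≡⟨ rearrange m (length l) (∑ dev l) ⟩
  length l * (m * m) + ∑ dev l + length l * (m * m)  ∎)
  where
  open ≡-Reasoning
  dev = λ x → ∣ f x - m ∣ * ∣ f x - m ∣
  rearrange : ∀ m n d → 2 * (m * (n * m)) + d ≡ n * (m * m) + d + n * (m * m)
  rearrange = solve-∀

∑≡0⇒All : ∀ (f : A → ℕ) l → ∑ f l ≡ 0 → All (λ x → f x ≡ 0) l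
∑≡0⇒All f []      _  = []
∑≡0⇒All f (x ∷ l) eq = m+n≡0⇒m≡0 (f x) eq ∷ ∑≡0⇒All f l (m+n≡0⇒n≡0 (f x) eq)

-- Concluding equality of labels, not just of their values, also makes `φ` injective when `k` is
-- positive.
Convex : (k s : ℕ) → (Fin s → ℕ) → Set
Convex k s φ = ∀ t (l : List (Fin s)) → length l ≡ k → ∑ φ l ≡ k * φ t → All (_≡ t) l

-- Behrend's construction: labels are digit vectors, and φ packs the vector (in a base that
-- leaves room for sums of k digits) together with its squared norm.
module Behrend (k r : ℕ) .{{k≢0 : NonZero k}} where

  lowDigit : ∀ D → Fin (r ^ suc D) → Fin r
  lowDigit D = quotient (r ^ D)

  highDigits : ∀ D → Fin (r ^ suc D) → Fin (r ^ D)
  highDigits D = remainder {r} (r ^ D)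

  packed : ∀ D → Fin (r ^ D) → ℕ
  packed zero    t = 0
  packed (suc D) t = toℕ (lowDigit D t) + k * r * packed D (highDigits D t)

  normSq : ∀ D → Fin (r ^ D) → ℕ
  normSq zero    t = 0
  normSq (suc D) t = toℕ (lowDigit D t) * toℕ (lowDigit D t) + normSq D (highDigits D t)

  packed-< : ∀ D t → packed D t < (k * r) ^ D
  packed-< zero    t = s≤s z≤n
  packed-< (suc D) t = digits-< (<-≤-trans (toℕ<n (lowDigit D t)) (m≤n*m r k)) (packed-< D (highDigits D t))

  normSq-≤ : ∀ D t → normSq D t ≤ D * (r * r)
  normSq-≤ zero    t = z≤n
  normSq-≤ (suc D) t = +-mono-≤ (*-mono-≤ d≤r d≤r) (normSq-≤ D (highDigits D t))
    where d≤r = <⇒≤ (toℕ<n (lowDigit D t))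

  ∑-packed-suc : ∀ D l → ∑ (packed (suc D)) l ≡ ∑ (λ t → toℕ (lowDigit D t)) l + k * r * ∑ (packed D) (map (highDigits D) l)
  ∑-packed-suc D l = trans (∑-+ (λ t → toℕ (lowDigit D t)) _ l) (cong (∑ _ l +_)
    (trans (∑-* (k * r) (λ t → packed D (highDigits D t)) l) (cong (k * r *_) (sym (∑-map (packed D) (highDigits D) l)))))

  -- Base `k * r` excludes carries, so equal packed sums force equal sums in every digit. The excess
  -- `e` is the total squared deviation of the vectors in `l` from `t`.
  normSq-deviation : ∀ D t (l : List (Fin (r ^ D))) → length l ≡ k → ∑ (packed D) l ≡ k * packed D t →
    ∃[ e ] (∑ (normSq D) l ≡ k * normSq D t + e × (e ≡ 0 → All (_≡ t) l))
  normSq-deviation zero t l len _ = 0 , trans (∑-const 0 l) (trans (*-zeroʳ (length l)) (sym (trans (+-identityʳ _) (*-zeroʳ k)))) , λ _ → trivial t l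
    where
    trivial : ∀ t (l : List (Fin 1)) → All (_≡ t) l
    trivial Fin.zero []      = []
    trivial Fin.zero (Fin.zero ∷ l) = refl ∷ trivial Fin.zero l
  normSq-deviation (suc D) t l refl eq = ∑ dev l + e , sum-eq , all-eq
    where
    low = λ t → toℕ (lowDigit D t)
    high = highDigits D
    dev = λ x → ∣ low x - low t ∣ * ∣ low x - low t ∣
    expand : ∀ c a b d → c * (a + b * d) ≡ c * a + b * (c * d)
    expand = solve-∀
    separated : ∑ low l ≡ k * low t × ∑ (packed D) (map high l) ≡ k * packed D (high t)
    separated = digits-unique (∑-< (λ x → toℕ<n (lowDigit D x)) l (>-nonZero⁻¹ k)) (*-monoʳ-< k (toℕ<n (lowDigit D t)))
      (trans (sym (∑-packed-suc D l)) (trans eq (expand k (low t) (k * r) (packed D (high t)))))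
    rec = normSq-deviation D (high t) (map high l) (length-map high l) (proj₂ separated)
    e = proj₁ rec
    rearrange : ∀ k a d g e → k * a + d + (k * g + e) ≡ k * (a + g) + (d + e)
    rearrange = solve-∀
    sum-eq : ∑ (normSq (suc D)) l ≡ k * normSq (suc D) t + (∑ dev l + e)
    sum-eq = trans (∑-+ (λ t → low t * low t) (λ t → normSq D (high t)) l)
      (trans (cong₂ _+_ (∑-square-deviation low (low t) l (proj₁ separated))
                        (trans (sym (∑-map (normSq D) high l)) (proj₁ (proj₂ rec))))
             (rearrange k (low t * low t) (∑ dev l) (normSq D (high t)) e))
    recombine : ∀ l → All (λ x → dev x ≡ 0) l → All (_≡ high t) (map high l) → All (_≡ t) l
    recombine []      []       []       = []
    recombine (x ∷ l) (p ∷ ps) (q ∷ qs) =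
      remQuot-injective {r} (r ^ D) (toℕ-injective (∣m-n∣≡0⇒m≡n (m*m≡0⇒m≡0 ∣ low x - low t ∣ p))) q ∷ recombine l ps qs
      where
      m*m≡0⇒m≡0 : ∀ m → m * m ≡ 0 → m ≡ 0
      m*m≡0⇒m≡0 zero _ = refl
    all-eq : ∑ dev l + e ≡ 0 → All (_≡ t) l
    all-eq z = recombine l (∑≡0⇒All dev l (m+n≡0⇒m≡0 (∑ dev l) z)) (proj₂ (proj₂ rec) (m+n≡0⇒n≡0 (∑ dev l) z))

  φ : ∀ D → Fin (r ^ D) → ℕ
  φ D t = packed D t + k * (k * r) ^ D * normSq D t

  φ-< : ∀ D t → φ D t < k * (k * r) ^ D * suc (D * (r * r))
  φ-< D t = digits-< (<-≤-trans (packed-< D t) (m≤n*m _ k)) (s≤s (normSq-≤ D t))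

  -- Equal packed parts say that `t` is the mean vector; equal norms then leave no squared
  -- deviation.
  φ-convex : ∀ D → Convex k (r ^ D) (φ D)
  φ-convex D t l refl eq = proj₂ (proj₂ deviation) (m+n≡m⇒n≡0 (trans (sym (proj₁ (proj₂ deviation))) (proj₂ separated)))
    where
    W = k * (k * r) ^ D
    expand : ∀ c a b d → c * (a + b * d) ≡ c * a + b * (c * d)
    expand = solve-∀
    separated : ∑ (packed D) l ≡ k * packed D t × ∑ (normSq D) l ≡ k * normSq D t
    separated = digits-unique (∑-< (packed-< D) l (>-nonZero⁻¹ k)) (*-monoʳ-< k (packed-< D t))
      (trans (sym (trans (∑-+ (packed D) (λ t → W * normSq D t) l) (cong (∑ (packed D) l +_) (∑-* W (normSq D) l))))
        (trans eq (expand k (packed D t) W (normSq D t))))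
    deviation = normSq-deviation D t l refl (proj₁ separated)
    m+n≡m⇒n≡0 : ∀ {m n} → m + n ≡ m → n ≡ 0
    m+n≡m⇒n≡0 {m} e = +-cancelˡ-≡ m _ 0 (trans e (sym (+-identityʳ m)))

-- Walks in the layered graph

isYes-true : ∀ {P : Set} (P? : Dec P) → P → isYes P? ≡ true
isYes-true (yes _) _ = refl
isYes-true (no ¬p) p = contradiction p ¬p

isYes-sound : ∀ {P : Set} (P? : Dec P) → isYes P? ≡ true → P
isYes-sound (yes p) _ = p

toℕ-mod : ∀ {m n} .{{_ : NonZero n}} → m < n → toℕ (m mod n) ≡ m
toℕ-mod {m} {n} m<n = trans (toℕ-fromℕ< (m%n<n m n)) (m<n⇒m%n≡m m<n)

record Site (s : ℕ) : Set where
  constructor site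
  field
    block offset x y : ℕ
    label            : Fin s
open Site

-- A site with label t lies on the chain of length L that carries the outgoing edge t of the
-- outer node (x , y) in the given block. Crossing to the next block adds φ t to the first
-- coordinate and exchanges the coordinates, so that the labels of even and odd blocks
-- accumulate in different coordinates. From an even block 2c, a crossing t → t′ lies on a
-- single path using t in all even and t′ in all odd blocks, and it is present iff the
-- selection contains the origin (x ∸ c φ t , y ∸ c φ t′ , t , t′) of that path.
module Layered {s : ℕ} (φ : Fin s → ℕ) (L : ℕ) (selected : ℕ → ℕ → Fin s → Fin s → Bool) where

  allowed : ℕ → ℕ → ℕ → Fin s → Fin s → Bool
  allowed zero          x y t t′ = selected x y t t′
  allowed (suc zero)    x y t t′ = true
  allowed (suc (suc i)) x y t t′ = allowed i (x ∸ φ t) (y ∸ φ t′) t t′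

  -- The truncated subtraction in `allowed` is exact at nodes of the path, so the recursion walks
  -- back to its origin.
  allowed-even : ∀ c x y t t′ → allowed (c * 2) (x + c * φ t) (y + c * φ t′) t t′ ≡ selected x y t t′
  allowed-even zero    x y t t′ rewrite +-identityʳ x | +-identityʳ y = refl
  allowed-even (suc c) x y t t′ = trans (cong₂ (λ a b → allowed (c * 2) a b t t′) (peel x (φ t) (c * φ t)) (peel y (φ t′) (c * φ t′))) (allowed-even c x y t t′)
    where
    peel : ∀ x a b → x + (a + b) ∸ a ≡ x + b
    peel x a b = trans (cong (_∸ a) (trans (cong (x +_) (+-comm a b)) (sym (+-assoc x b a)))) (m+n∸n≡m (x + b) a)

  allowed-odd : ∀ c x y t t′ → allowed (suc (c * 2)) x y t t′ ≡ true
  allowed-odd zero    x y t t′ = refl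
  allowed-odd (suc c) x y t t′ = allowed-odd c _ _ t t′

  Along Cross Edge : Site s → Site s → Set
  Along u v = offset u < L × block v ≡ block u × offset v ≡ suc (offset u) × x v ≡ x u × y v ≡ y u × label v ≡ label u
  Cross u v = offset u ≡ L × block v ≡ suc (block u) × offset v ≡ 0 × x v ≡ y u × y v ≡ x u + φ (label u) ×
              allowed (block u) (x u) (y u) (label u) (label v) ≡ true
  Edge u v = Along u v ⊎ Cross u v

  edge? : ∀ u v → Dec (Edge u v)
  edge? u v =
    (offset u <? L ×-dec block v ≟ block u ×-dec offset v ≟ suc (offset u) ×-dec x v ≟ x u ×-dec y v ≟ y u ×-dec label v ≟ᶠ label u)
    ⊎-dec
    (offset u ≟ L ×-dec block v ≟ suc (block u) ×-dec offset v ≟ 0 ×-dec x v ≟ y u ×-dec y v ≟ x u + φ (label u) ×-dec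
     allowed (block u) (x u) (y u) (label u) (label v) ≟ᵇ true)

  layer : Site s → ℕ
  layer u = block u * suc L + offset u

  edge-layer : ∀ {u v} → Edge u v → layer v ≡ suc (layer u)
  edge-layer {site i j _ _ _} (inj₁ (_ , refl , refl , _)) = +-suc (i * suc L) j
  edge-layer {site i _ _ _ _} (inj₂ (refl , refl , refl , _)) = trans (+-identityʳ _) (trans (+-comm (suc L) _) (+-suc _ L))

  data Route : Site s → Site s → ℕ → Set where
    []  : ∀ {u} → Route u u 0
    _∷_ : ∀ {u w v m} → Edge u w ⊎ Edge w u → Route w v m → Route u v (suc m)

  module From (x₀ y₀ : ℕ) where

    -- The coordinates reached by a list of block labels, most recent first.
    posX posY : List (Fin s) → ℕ
    posX []      = x₀
    posX (t ∷ h) = posY h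
    posY []      = y₀
    posY (t ∷ h) = posX h + φ t

    penalty : Bool → ℕ
    penalty b = if b then 0 else 1

    -- The absent crossings between consecutive labels of a history: each one has to be bypassed by
    -- a step backward.
    missing : List (Fin s) → ℕ
    missing []           = 0
    missing (t ∷ [])     = 0
    missing (t′ ∷ t ∷ h) = missing (t ∷ h) + penalty (allowed (length h) (posX h) (posY h) t t′)

    missing-∷-≥ : ∀ t h → missing h ≤ missing (t ∷ h)
    missing-∷-≥ t []      = z≤n
    missing-∷-≥ t (_ ∷ h) = m≤m+n _ _

    missing-∷-≤ : ∀ t h → missing (t ∷ h) ≤ suc (missing h)
    missing-∷-≤ t []      = z≤n
    missing-∷-≤ t′ (t ∷ h) = ≤-trans (+-monoʳ-≤ (missing (t ∷ h)) (penalty≤1 (allowed (length h) (posX h) (posY h) t t′))) (≤-reflexive (+-comm _ 1))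
      where
      penalty≤1 : ∀ b → penalty b ≤ 1
      penalty≤1 true  = z≤n
      penalty≤1 false = s≤s z≤n

    -- What is known of the endpoint u of a walk that has made b backward steps: h lists the
    -- labels of the blocks crossed for good. In the state `retreated` the walk has stepped
    -- back from the node reached by h into some chain leading to it; leaving that chain at
    -- its far end costs L further backward steps, after which the state is `lost`.
    data State (u : Site s) (b : ℕ) : Set where
      advancing : ∀ h → block u ≡ length h → x u ≡ posX h → y u ≡ posY h → missing (label u ∷ h) ≤ b → State u b
      retreated : ∀ h → suc (block u) ≡ length h → y u ≡ posX h → x u + φ (label u) ≡ posY h →
                  suc (missing h + (L ∸ offset u)) ≤ b → State u b
      lost      : suc L ≤ b → State u b

    forward : ∀ {u v b} → State u b → Edge u v → State v b
    forward (lost p) _ = lost p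
    forward (advancing h i≡ x≡ y≡ p) (inj₁ (_ , refl , _ , refl , refl , refl)) = advancing h i≡ x≡ y≡ p
    forward {site _ _ _ _ t} {site _ _ _ _ t′} (advancing h refl refl refl p) (inj₂ (_ , refl , _ , refl , refl , ok)) =
      advancing (t ∷ h) refl refl refl (≤-trans (≤-reflexive (trans (cong (λ b → missing (t ∷ h) + penalty b) ok) (+-identityʳ _))) p)
    forward {site _ j _ _ _} (retreated h i≡ y≡ x≡ p) (inj₁ (_ , refl , refl , refl , refl , refl)) =
      retreated h i≡ y≡ x≡ (≤-trans (s≤s (+-monoʳ-≤ (missing h) (∸-monoʳ-≤ L (n≤1+n j)))) p)
    -- Entering another chain may bypass one absent crossing; the backward step that began the
    -- retreat pays for it.
    forward {v = v} (retreated h i≡ y≡ x≡ p) (inj₂ (_ , refl , _ , refl , refl , _)) =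
      advancing h i≡ y≡ x≡ (≤-trans (missing-∷-≤ (label v) h) (≤-trans (s≤s (m≤m+n _ _)) p))

    backward : ∀ {u v b} → State u b → Edge v u → State v (suc b)
    backward (lost p) _ = lost (m≤n⇒m≤1+n p)
    backward (advancing h i≡ x≡ y≡ p) (inj₁ (_ , refl , _ , refl , refl , refl)) = advancing h i≡ x≡ y≡ (m≤n⇒m≤1+n p)
    -- The retreat begins at the last site of an incoming chain, where `L ∸ offset` is zero.
    backward {u} (advancing h i≡ x≡ y≡ p) (inj₂ (refl , refl , _ , refl , refl , _)) =
      retreated h i≡ x≡ y≡ (s≤s (≤-trans (≤-reflexive (trans (cong (missing h +_) (n∸n≡0 L)) (+-identityʳ _))) (≤-trans (missing-∷-≥ (label u) h) p)))
    backward {v = site _ j _ _ _} (retreated h i≡ y≡ x≡ p) (inj₁ (_ , refl , refl , refl , refl , refl)) =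
      retreated h i≡ y≡ x≡ (s≤s (≤-trans (+-monoʳ-≤ (missing h) (∸-suc-≤ L j)) (≤-trans (≤-reflexive (+-suc _ _)) p)))
      where
      ∸-suc-≤ : ∀ m n → m ∸ n ≤ suc (m ∸ suc n)
      ∸-suc-≤ zero    zero    = z≤n
      ∸-suc-≤ zero    (suc n) = z≤n
      ∸-suc-≤ (suc m) zero    = ≤-refl
      ∸-suc-≤ (suc m) (suc n) = ∸-suc-≤ m n
    -- At offset 0 a whole chain has been retraced, so `b` already exceeds `L`.
    backward (retreated h i≡ y≡ x≡ p) (inj₂ (_ , _ , refl , _)) = lost (m≤n⇒m≤1+n (≤-trans (s≤s (m≤n+m L (missing h))) p))

    -- A forward step raises `layer` by one and a backward step lowers it by one, so the length is
    -- the gain in `layer` plus twice the number of backward steps.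
    route-state : ∀ {u v m b} → State u b → Route u v m → ∃[ b′ ] (State v b′ × m + layer u + 2 * b ≡ layer v + 2 * b′)
    route-state st [] = _ , st , refl
    route-state {u} {m = suc m} {b} st (_∷_ {w = w} (inj₁ e) r) with route-state (forward st e) r
    ... | b′ , st′ , eq = b′ , st′ , trans (cong (_+ 2 * b) (trans (sym (+-suc m (layer u))) (cong (m +_) (sym (edge-layer e))))) eq
    route-state {u} {m = suc m} {b} st (_∷_ {w = w} (inj₂ e) r) with route-state (backward st e) r
    ... | b′ , st′ , eq = b′ , st′ , trans (cong (λ l → suc m + l + 2 * b) (edge-layer e)) (trans (shift m (layer w) b) eq)
      where
      shift : ∀ m l b → suc m + suc l + 2 * b ≡ m + l + 2 * suc b
      shift = solve-∀

    -- Histories start with the most recent label, so at even length the head belongs to an odd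
    -- block.
    evens odds : List (Fin s) → List (Fin s)
    evens (w ∷ v ∷ h) = v ∷ evens h
    evens _           = []
    odds (w ∷ v ∷ h)  = w ∷ odds h
    odds _            = []

    snoc : ∀ z {p a b} → p ≡ z + b → p + a ≡ z + (a + b)
    snoc z {_} {a} {b} refl = trans (+-assoc z b a) (cong (z +_) (+-comm b a))

    unzip-position : ∀ c h → length h ≡ c * 2 →
      length (evens h) ≡ c × length (odds h) ≡ c × posX h ≡ x₀ + ∑ φ (evens h) × posY h ≡ y₀ + ∑ φ (odds h)
    unzip-position zero    []          _  = refl , refl , sym (+-identityʳ x₀) , sym (+-identityʳ y₀)
    unzip-position (suc c) (w ∷ [])    ()
    unzip-position (suc c) (w ∷ v ∷ h) eq with unzip-position c h (suc-injective (suc-injective eq))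
    ... | le , lo , px , py = cong suc le , cong suc lo , snoc x₀ px , snoc y₀ py

    -- With constant labels, each crossing out of an even block lies on the path with origin `x₀`,
    -- `y₀`, `v`, `w`, so `allowed-even` shows it absent.
    all-missing : ∀ {v w} c h → length h ≡ c * 2 → All (_≡ v) (evens h) → All (_≡ w) (odds h) → selected x₀ y₀ v w ≡ false →
      c ≤ missing h × posX h ≡ x₀ + c * φ v × posY h ≡ y₀ + c * φ w
    all-missing zero [] _ _ _ _ = z≤n , sym (+-identityʳ x₀) , sym (+-identityʳ y₀)
    all-missing (suc c) (w ∷ []) ()
    all-missing (suc c) (w ∷ v ∷ h) eq (refl ∷ ev) (refl ∷ ow) unsel with all-missing c h (suc-injective (suc-injective eq)) ev ow unsel
    ... | c≤ , px , py = bound , snoc x₀ px , snoc y₀ py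
      where
      forbidden : allowed (length h) (posX h) (posY h) v w ≡ false
      forbidden rewrite suc-injective (suc-injective eq) | px | py = trans (allowed-even c x₀ y₀ v w) unsel
      bound : suc c ≤ missing (v ∷ h) + penalty (allowed (length h) (posX h) (posY h) v w)
      bound rewrite forbidden = ≤-trans (s≤s (≤-trans c≤ (missing-∷-≥ v h))) (≤-reflexive (+-comm 1 _))

  source : ℕ → ℕ → Fin s → Site s
  source x y v = site 0 0 x y v

  -- The end of the path with origin (x , y , v , w), at the start of block 2k.
  target : ℕ → ℕ → ℕ → Fin s → Fin s → Site s
  target k x y v w = site (k * 2) 0 (x + k * φ v) (y + k * φ w) v

  unselected-far : ∀ {k x y v w m} → Convex k s φ → k ≤ suc L → selected x y v w ≡ false →
    Route (source x y v) (target k x y v w) m → k * 2 * suc L + 2 * k ≤ m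
  unselected-far {k} {x} {y} {v} {w} {m} convex k≤ unsel r = begin
    k * 2 * suc L + 2 * k       ≤⟨ +-monoʳ-≤ (k * 2 * suc L) (*-monoʳ-≤ 2 (enough st)) ⟩
    k * 2 * suc L + 2 * b       ≡⟨ cong (_+ 2 * b) (+-identityʳ (k * 2 * suc L)) ⟨
    k * 2 * suc L + 0 + 2 * b   ≡⟨ eq ⟨
    m + 0 + 0                   ≡⟨ trans (+-identityʳ (m + 0)) (+-identityʳ m) ⟩
    m                           ∎
    where
    open ≤-Reasoning
    open From x y
    final = route-state {b = 0} (advancing [] refl refl refl z≤n) r
    b = proj₁ final
    st = proj₁ (proj₂ final)
    eq = proj₂ (proj₂ final)
    enough : ∀ {b} → State (target k x y v w) b → k ≤ b
    enough (lost p) = ≤-trans k≤ p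
    enough (retreated h _ _ _ p) = ≤-trans k≤ (≤-trans (s≤s (m≤n+m L (missing h))) p)
    enough (advancing h i≡ x≡ y≡ p) with unzip-position k h (sym i≡)
    ... | le , lo , px , py = ≤-trans (proj₁ (all-missing k h (sym i≡) all-v all-w unsel)) (≤-trans (missing-∷-≥ v h) p)
      where
      -- The coordinates of the target fix the sums of the `k` even and the `k` odd labels;
      -- convexity makes both lists constant.
      all-v = convex v (evens h) le (sym (+-cancelˡ-≡ x _ _ (trans x≡ px)))
      all-w = convex w (odds h) lo (sym (+-cancelˡ-≡ y _ _ (trans y≡ py)))

-- The finite graphs

_++ʷ_ : ∀ {n} {G : Graph n} {u v w k m} → Walk G u v k → Walk G v w m → Walk G u w (k + m)
here       ++ʷ q = q
(step e p) ++ʷ q = step e (p ++ʷ q)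

module Finite {s : ℕ} (φ : Fin s → ℕ) (L : ℕ) (selected : ℕ → ℕ → Fin s → Fin s → Bool)
              (blocks X : ℕ) .{{_ : NonZero blocks}} .{{_ : NonZero X}} where

  open Layered φ L selected

  order : ℕ
  order = blocks * (suc L * (X * (X * s)))

  -- One stage per factor, so that `decode-encode` can apply `remQuot-combine` once at each stage
  -- under `cong`.
  decode₁ : Fin blocks × Fin (suc L * (X * (X * s))) → Site s
  decode₂ : Fin blocks → Fin (suc L) × Fin (X * (X * s)) → Site s
  decode₃ : Fin blocks → Fin (suc L) → Fin X × Fin (X * s) → Site s
  decode₄ : Fin blocks → Fin (suc L) → Fin X → Fin X × Fin s → Site s
  decode₁ (i , u)       = decode₂ i (remQuot (X * (X * s)) u)
  decode₂ i (j , u)     = decode₃ i j (remQuot (X * s) u)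
  decode₃ i j (x , u)   = decode₄ i j x (remQuot s u)
  decode₄ i j x (y , t) = site (toℕ i) (toℕ j) (toℕ x) (toℕ y) t

  decode : Fin order → Site s
  decode u = decode₁ (remQuot (suc L * (X * (X * s))) u)

  -- Out-of-range sites are reduced modulo the ranges; decode-encode excludes them.
  encode : Site s → Fin order
  encode (site i j x y t) = combine (i mod blocks) (combine (j mod suc L) (combine (x mod X) (combine (y mod X) t)))

  InRange : Site s → Set
  InRange u = block u < blocks × offset u < suc L × x u < X × y u < X

  decode-encode : ∀ {u} → InRange u → decode (encode u) ≡ u
  decode-encode {site i j x y t} (i< , j< , x< , y<) =
    trans (cong decode₁ (remQuot-combine (i mod blocks) _))
    (trans (cong (decode₂ (i mod blocks)) (remQuot-combine (j mod suc L) _))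
    (trans (cong (decode₃ (i mod blocks) (j mod suc L)) (remQuot-combine (x mod X) _))
    (trans (cong (decode₄ (i mod blocks) (j mod suc L) (x mod X)) (remQuot-combine (y mod X) t))
    (site-cong (toℕ-mod i<) (toℕ-mod j<) (toℕ-mod x<) (toℕ-mod y<)))))
    where
    site-cong : ∀ {i i′ j j′ x x′ y y′} → i ≡ i′ → j ≡ j′ → x ≡ x′ → y ≡ y′ → site i j x y t ≡ site i′ j′ x′ y′ t
    site-cong refl refl refl refl = refl

  linked : Site s → Site s → Bool
  linked u v = isYes (edge? u v) ∨ isYes (edge? v u)

  edge⇒linked : ∀ u v → Edge u v → linked u v ≡ true
  edge⇒linked u v e = cong (_∨ isYes (edge? v u)) (isYes-true (edge? u v) e)

  linked⇒edge : ∀ u v → linked u v ≡ true → Edge u v ⊎ Edge v u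
  linked⇒edge u v eq with isYes (edge? u v) in e
  ... | true  = inj₁ (isYes-sound (edge? u v) e)
  ... | false = inj₂ (isYes-sound (edge? v u) eq)

  no-self-edge : ∀ u → ¬ Edge u u
  no-self-edge u e = m≢1+m+n (layer u) (trans (edge-layer {u} {u} e) (cong suc (sym (+-identityʳ _))))

  graph : Graph order
  graph = record
    { adj    = λ u v → linked (decode u) (decode v)
    ; sym    = λ u v → ∨-comm (isYes (edge? (decode u) (decode v))) _
    ; irrefl = λ u eq → irreflexive (decode u) (linked⇒edge _ _ eq)
    }
    where
    irreflexive : ∀ u → ¬ (Edge u u ⊎ Edge u u)
    irreflexive u (inj₁ e) = no-self-edge u e
    irreflexive u (inj₂ e) = no-self-edge u e

  edge⇒adjacent : ∀ u v → InRange u → InRange v → Edge u v → adj graph (encode u) (encode v) ≡ true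
  edge⇒adjacent u v u-in v-in e = trans (cong₂ linked (decode-encode {u} u-in) (decode-encode {v} v-in)) (edge⇒linked u v e)

  walk⇒route : ∀ {u v m} → Walk graph u v m → Route (decode u) (decode v) m
  walk⇒route here               = []
  walk⇒route (step {u} {w} e p) = linked⇒edge (decode u) (decode w) e ∷ walk⇒route p

  InBox : ℕ → ℕ → ℕ → Set
  InBox i x y = i < blocks × x < X × y < X

  chain-walk : ∀ {i x y} t → InBox i x y → ∀ j → j ≤ L → Walk graph (encode (site i 0 x y t)) (encode (site i j x y t)) j
  chain-walk t _ zero _ = here
  chain-walk {i} {x} {y} t (i< , x< , y<) (suc j) j<L = subst (Walk graph _ _) (+-comm j 1)
    (chain-walk t (i< , x< , y<) j (<⇒≤ j<L) ++ʷ
      step (edge⇒adjacent (site i j x y t) (site i (suc j) x y t) (i< , m≤n⇒m≤1+n j<L , x< , y<) (i< , s≤s j<L , x< , y<)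
        (inj₁ (j<L , refl , refl , refl , refl , refl))) here)

  block-walk : ∀ {i x y x′} t t′ → InBox i x y → InBox (suc i) y x′ → x′ ≡ x + φ t → allowed i x y t t′ ≡ true →
    Walk graph (encode (site i 0 x y t)) (encode (site (suc i) 0 y x′ t′)) (suc L)
  block-walk {i} {x} {y} {x′} t t′ box@(i< , x< , y<) (i′< , _ , x′<) eq ok = subst (Walk graph _ _) (+-comm L 1)
    (chain-walk t box L ≤-refl ++ʷ
      step (edge⇒adjacent (site i L x y t) (site (suc i) 0 y x′ t′) (i< , ≤-refl , x< , y<) (i′< , s≤s z≤n , y< , x′<)
        (inj₂ (refl , refl , refl , refl , eq , ok))) here)

  -- Each round makes one even crossing, present by selection, and one odd crossing, always present.
  -- Coordinates only grow along the path, so bounds at its end suffice.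
  selected-walk : ∀ k {x y v w} → k * 2 < blocks → x + k * φ v < X → y + k * φ w < X → selected x y v w ≡ true →
    Walk graph (encode (source x y v)) (encode (target k x y v w)) (k * 2 * suc L)
  selected-walk zero {x} {y} {v} {w} _ _ _ _ rewrite +-identityʳ x | +-identityʳ y = here
  selected-walk (suc k) {x} {y} {v} {w} i< x< y< sel = subst (Walk graph _ _) (rearrange (k * 2 * suc L) (suc L))
    (selected-walk k i<₀ x<₀ y<₀ sel ++ʷ
      (block-walk v w (i<₀ , x<₀ , y<₀) (i<₁ , y<₀ , x<) (shift x (φ v) (k * φ v)) (trans (allowed-even k x y v w) sel) ++ʷ
       block-walk w v (i<₁ , y<₀ , x<) (i< , x< , y<) (shift y (φ w) (k * φ w)) (allowed-odd k (y + k * φ w) (x + suc k * φ v) w v)))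
    where
    i<₁ = <-trans (n<1+n _) i<
    i<₀ = <-trans (n<1+n _) i<₁
    x<₀ = ≤-<-trans (+-monoʳ-≤ x (m≤n+m (k * φ v) (φ v))) x<
    y<₀ = ≤-<-trans (+-monoʳ-≤ y (m≤n+m (k * φ w) (φ w))) y<
    shift : ∀ x a b → x + (a + b) ≡ x + b + a
    shift = solve-∀
    rearrange : ∀ a l → a + (l + l) ≡ l + (l + a)
    rearrange = solve-∀

  unselected-walk-length : ∀ {k x y v w m} → Convex k s φ → k ≤ suc L →
    k * 2 < blocks → x + k * φ v < X → y + k * φ w < X → selected x y v w ≡ false →
    Walk graph (encode (source x y v)) (encode (target k x y v w)) m → k * 2 * suc L + 2 * k ≤ m
  unselected-walk-length {k} {x} {y} {v} {w} {m} convex k≤ i< x< y< unsel p = unselected-far {k} convex k≤ unsel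
    (subst (λ u → Route u (target k x y v w) m) (decode-encode {source x y v} source-in)
      (subst (λ u → Route _ u m) (decode-encode {target k x y v w} (i< , s≤s z≤n , x< , y<)) (walk⇒route p)))
    where
    source-in : InRange (source x y v)
    source-in = ≤-<-trans z≤n i< , s≤s z≤n , ≤-<-trans (m≤m+n x _) x< , ≤-<-trans (m≤m+n y _) y<

-- A common finite output would be below `T + gap` by its error in `G`, yet at least the distance in
-- `G′`.
estimate-separates : ∀ {n a b T gap} {G G′ : Graph n} {u v} → Walk G u v T → (∀ m → Walk G′ u v m → T + gap ≤ m) →
  (∀ e → e ^ b ≤ n ^ a → e < gap) → ∀ o → GoodEstimate a b G u v o → ¬ GoodEstimate a b G′ u v o
estimate-separates near far small nothing unreachable _ = unreachable (_ , near)
estimate-separates {T = T} {gap} near far small (just d) (k , (_ , k-min) , k≤d , err) (k′ , (p′ , _) , k′≤d , _) = <-irrefl refl (begin-strict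
  d             ≡⟨ m+[n∸m]≡n k≤d ⟨
  k + (d ∸ k)   <⟨ +-mono-≤-< (k-min T near) (small (d ∸ k) err) ⟩
  T + gap       ≤⟨ far k′ p′ ⟩
  k′            ≤⟨ k′≤d ⟩
  d             ∎)
  where open ≤-Reasoning

-- Counting bitstrings

bijectiveBinary : List Bool → ℕ
bijectiveBinary []          = 0
bijectiveBinary (false ∷ l) = 1 + 2 * bijectiveBinary l
bijectiveBinary (true ∷ l)  = 2 + 2 * bijectiveBinary l

-- Digits 1 and 2 instead of 0 and 1 leave no leading zeros, so the length of a string is not lost.
bijectiveBinary-injective : ∀ l l′ → bijectiveBinary l ≡ bijectiveBinary l′ → l ≡ l′
bijectiveBinary-injective []          []           _ = refl
bijectiveBinary-injective []          (false ∷ l′) ()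
bijectiveBinary-injective []          (true ∷ l′)  ()
bijectiveBinary-injective (false ∷ l) []           ()
bijectiveBinary-injective (true ∷ l)  []           ()
bijectiveBinary-injective (false ∷ l) (false ∷ l′) eq = cong (false ∷_) (bijectiveBinary-injective l l′ (*-cancelˡ-≡ _ _ 2 (suc-injective eq)))
bijectiveBinary-injective (true ∷ l)  (true ∷ l′)  eq = cong (true ∷_) (bijectiveBinary-injective l l′ (*-cancelˡ-≡ _ _ 2 (suc-injective (suc-injective eq))))
bijectiveBinary-injective (false ∷ l) (true ∷ l′)  eq = contradiction (suc-injective eq) (even≢odd (bijectiveBinary l) (bijectiveBinary l′))
bijectiveBinary-injective (true ∷ l)  (false ∷ l′) eq = contradiction (sym (suc-injective eq)) (even≢odd (bijectiveBinary l′) (bijectiveBinary l))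

bijectiveBinary-< : ∀ l → suc (bijectiveBinary l) < 2 * 2 ^ length l
bijectiveBinary-< []      = ≤-refl
bijectiveBinary-< (b ∷ l) = ≤-trans (s≤s (s≤s (digit b))) (≤-trans (≤-reflexive (double (bijectiveBinary l))) (*-monoʳ-≤ 2 (bijectiveBinary-< l)))
  where
  digit : ∀ b → bijectiveBinary (b ∷ l) ≤ 2 + 2 * bijectiveBinary l
  digit true  = ≤-refl
  digit false = n≤1+n _
  double : ∀ c → 2 + (2 + 2 * c) ≡ 2 * (2 + c)
  double = solve-∀

-- There are only 2^Q ∸ 1 bitstrings of length less than Q.
no-short-injection : ∀ Q (f : Fin (2 ^ Q) → List Bool) → (∀ {i j} → f i ≡ f j → i ≡ j) → ¬ (∀ i → length (f i) < Q)
no-short-injection Q f f-inj short = <-irrefl refl (≤-trans (≤-reflexive (suc-pred (2 ^ Q) {{m^n≢0 2 Q}})) (injective⇒≤ code-injective))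
  where
  code-< : ∀ i → bijectiveBinary (f i) < pred (2 ^ Q)
  code-< i = <⇒≤pred (<-≤-trans (bijectiveBinary-< (f i)) (^-monoʳ-≤ 2 (short i)))
  code : Fin (2 ^ Q) → Fin (pred (2 ^ Q))
  code i = fromℕ< (code-< i)
  code-injective : ∀ {i j} → code i ≡ code j → i ≡ j
  code-injective {i} {j} eq = f-inj (bijectiveBinary-injective _ _
    (trans (sym (toℕ-fromℕ< (code-< i))) (trans (cong toℕ eq) (toℕ-fromℕ< (code-< j)))))

funToFin-cong : ∀ {m n} {f g : Fin m → Fin n} → (∀ i → f i ≡ g i) → funToFin f ≡ funToFin g
funToFin-cong {zero}  _   = refl
funToFin-cong {suc m} f≗g = cong₂ combine (f≗g Fin.zero) (funToFin-cong (λ i → f≗g (Fin.suc i)))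

finToFun-injective : ∀ {m n} {i j : Fin (m ^ n)} → (∀ k → finToFun {m} {n} i k ≡ finToFun j k) → i ≡ j
finToFun-injective {m} {n} {i} {j} eq = trans (sym (funToFin-finToFin {n} {m} i)) (trans (funToFin-cong eq) (funToFin-finToFin {n} {m} j))

-- The family of graphs indexed by selections

module Family (k s L X₀ blocks X : ℕ) .{{_ : NonZero blocks}} .{{_ : NonZero X}} .{{_ : NonZero X₀}} (φ : Fin s → ℕ) (convex : Convex k s φ)
              (k≤ : k ≤ suc L) (k< : k * 2 < blocks) (fits : ∀ x v → x < X₀ → x + k * φ v < X) where

  Q : ℕ
  Q = X₀ * (X₀ * (s * s))

  isOne : Fin 2 → Bool
  isOne Fin.zero    = false
  isOne (Fin.suc _) = true

  isOne-injective : ∀ i j → isOne i ≡ isOne j → i ≡ j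
  isOne-injective Fin.zero           Fin.zero           _ = refl
  isOne-injective (Fin.suc Fin.zero) (Fin.suc Fin.zero) _ = refl

  -- Reduction modulo `X₀` makes the selection total; the origins below `X₀` carry the `Q`
  -- independent bits.
  selection : Fin (2 ^ Q) → ℕ → ℕ → Fin s → Fin s → Bool
  selection N x y v w = isOne (finToFun {2} {Q} N (combine (x mod X₀) (combine (y mod X₀) (combine v w))))

  selection-injective : ∀ {N N′} → (∀ x y v w → x < X₀ → y < X₀ → selection N x y v w ≡ selection N′ x y v w) → N ≡ N′
  selection-injective {N} {N′} eq = finToFun-injective bit
    where
    bit : ∀ i → finToFun {2} {Q} N i ≡ finToFun N′ i
    bit i with remQuot {X₀} (X₀ * (s * s)) i in e₁
    ... | a , i₁ with remQuot {X₀} (s * s) i₁ in e₂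
    ... | b , i₂ with remQuot {s} s i₂ in e₃
    ... | v , w = subst (λ i → finToFun {2} {Q} N i ≡ finToFun N′ i) index
                    (isOne-injective _ _ (eq (toℕ a) (toℕ b) v w (toℕ<n a) (toℕ<n b)))
      where
      clip : ∀ (c : Fin X₀) → toℕ c mod X₀ ≡ c
      clip c = toℕ-injective (toℕ-mod (toℕ<n c))
      join : ∀ {m n} {i : Fin (m * n)} {p} → remQuot {m} n i ≡ p → combine (proj₁ p) (proj₂ p) ≡ i
      join {m} {n} {i} refl = combine-remQuot {m} n i
      index : combine (toℕ a mod X₀) (combine (toℕ b mod X₀) (combine v w)) ≡ i
      index = trans (cong₂ combine (clip a) (trans (cong₂ combine (clip b) (join e₃)) (join e₂))) (join e₁)

  open Finite using (graph)

  order : ℕ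
  order = blocks * (suc L * (X * (X * s)))

  member : Fin (2 ^ Q) → Graph order
  member N = graph φ L (selection N) blocks X

  -- Where two selections differ, the ends of the path are at least `2 * k` further apart in one
  -- graph than in the other, so one bitstring cannot serve both.
  sketch-injective : ∀ {a b} (ψ : Graph order → List Bool) (dec : List Bool → Fin order → Fin order → Maybe ℕ) →
    (∀ e → e ^ b ≤ order ^ a → e < 2 * k) →
    (∀ G u v → GoodEstimate a b G u v (dec (ψ G) u v)) →
    ∀ {N N′} → ψ (member N) ≡ ψ (member N′) → N ≡ N′
  sketch-injective {a} {b} ψ dec small good {N} {N′} eq = selection-injective same
    where
    differ : ∀ {N N′ x y v w} → ψ (member N) ≡ ψ (member N′) → x < X₀ → y < X₀ →
             selection N x y v w ≡ true → ¬ (selection N′ x y v w ≡ false)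
    differ {N} {N′} {x} {y} {v} {w} eq x< y< sel unsel =
      estimate-separates {G = member N} {G′ = member N′} {u = src} {v = tgt}
        (Finite.selected-walk φ L (selection N) blocks X k k< (fits x v x<) (fits y w y<) sel)
        (λ m p → Finite.unselected-walk-length φ L (selection N′) blocks X {k} convex k≤ k< (fits x v x<) (fits y w y<) unsel p)
        small (dec (ψ (member N)) src tgt)
        (good (member N) src tgt)
        (subst (λ l → GoodEstimate a b (member N′) src tgt (dec l src tgt)) (sym eq) (good (member N′) src tgt))
      where
      -- Encoding does not depend on the selection, so these are also the ends in `member N′`.
      src = Finite.encode φ L (selection N) blocks X (Layered.source φ L (selection N) x y v)
      tgt = Finite.encode φ L (selection N) blocks X (Layered.target φ L (selection N) k x y v w)
    same : ∀ x y v w → x < X₀ → y < X₀ → selection N x y v w ≡ selection N′ x y v w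
    same x y v w x< y< with selection N x y v w in p | selection N′ x y v w in p′
    ... | true  | true  = refl
    ... | false | false = refl
    ... | true  | false = contradiction p′ (differ {N} {N′} eq x< y< p)
    ... | false | true  = contradiction p (differ {N′} {N} (sym eq) x< y< p′)

-- Choice of the parameters

-- The parameters of the family are powers of κ: labels, coordinate range of the origins,
-- order of the graphs and number of selectable paths.
labelExp rangeExp orderExp pathsExp : ℕ → ℕ
labelExp q = 3 * q * (3 * q)
rangeExp q = 1 + (1 + 3 * q) * (3 * q) + (1 + (3 * q + 3 * q))
orderExp q = 2 + (1 + ((2 + rangeExp q) + ((2 + rangeExp q) + labelExp q)))
pathsExp q = rangeExp q + (rangeExp q + (labelExp q + labelExp q))

-- Only p ≥ 1 is used, whence the factor 3 in place of 3p.
exponent-gap : ∀ q → 3 * q + orderExp q * (4 * q) ≤ pathsExp q * (3 * q) + orderExp q * 3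
-- The summand is the exact difference of the two sides. The cubic terms cancel, 36 times 3 against
-- 27 times 4: this is the exponent 4/3.
exponent-gap q = ≤-trans (m≤m+n _ (63 * (q * q) + 19 * q + 33)) (≤-reflexive (expand q))
  where
  expand : ∀ q → let l = 3 * q * (3 * q)
                     ρ = 1 + (1 + 3 * q) * (3 * q) + (1 + (3 * q + 3 * q))
                     ν = 2 + (1 + ((2 + ρ) + ((2 + ρ) + l)))
                 in 3 * q + ν * (4 * q) + (63 * (q * q) + 19 * q + 33) ≡ (ρ + (ρ + (l + l))) * (3 * q) + ν * 3
  expand = solve-∀

module Parameters (p q κ L C : ℕ) (0<p : 0 < p) (0<q : 0 < q) (L≡ : suc L ≡ κ) (2<κ : 2 < κ) (C<κ : C < κ) (3q<κ : 3 * q < κ) where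

  instance
    κ≢0 : NonZero κ
    κ≢0 = >-nonZero (≤-<-trans z≤n 2<κ)
    q≢0 : NonZero (3 * q)
    q≢0 = >-nonZero (≤-trans 0<q (m≤m+n q _))

  -- With `3 * q` digits below `r`, the exponents of `s` and `R` over `κ` share the leading term
  -- 9q²; the cost of the packing is only linear in q.
  r s R X : ℕ
  r = κ ^ (3 * q)
  s = r ^ (3 * q)
  R = κ * (κ * r) ^ (3 * q) * (κ * (r * r))
  X = κ * κ * R

  -- A datatype rather than the bare equation, so that exponents can be inferred.
  data Power (a i : ℕ) : Set where
    power : a ≡ κ ^ i → Power a i

  power-≡ : ∀ {a i} → Power a i → a ≡ κ ^ i
  power-≡ (power eq) = eq

  power-* : ∀ {a b i j} → Power a i → Power b j → Power (a * b) (i + j)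
  power-* {i = i} {j} (power refl) (power refl) = power (sym (^-distribˡ-+-* κ i j))

  power-^ : ∀ {a i} j → Power a i → Power (a ^ j) (i * j)
  power-^ {i = i} j (power refl) = power (^-*-assoc κ i j)

  κ-power : Power κ 1
  κ-power = power (sym (^-identityʳ κ))

  r-power : Power r (3 * q)
  r-power = power refl

  s-power : Power s (labelExp q)
  s-power = power-^ (3 * q) r-power

  R-power : Power R (rangeExp q)
  R-power = power-* (power-* κ-power (power-^ (3 * q) (power-* κ-power r-power))) (power-* κ-power (power-* r-power r-power))

  X-power : Power X (2 + rangeExp q)
  X-power = power-* (power-* κ-power κ-power) R-power

  power-nonZero : ∀ {a i} → Power a i → NonZero a
  power-nonZero {i = i} (power refl) = m^n≢0 κ i

  instance
    R≢0 : NonZero R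
    R≢0 = power-nonZero R-power
    X≢0 : NonZero X
    X≢0 = power-nonZero X-power
    κκ≢0 : NonZero (κ * κ)
    κκ≢0 = m*n≢0 κ κ

  open Behrend κ r

  φ-<-R : ∀ t → φ (3 * q) t < R
  φ-<-R t = <-≤-trans (φ-< (3 * q) t) (*-monoʳ-≤ (κ * (κ * r) ^ (3 * q)) (begin
    suc (3 * q * (r * r))   ≤⟨ +-monoˡ-≤ (3 * q * (r * r)) (*-mono-≤ (m^n>0 κ (3 * q)) (m^n>0 κ (3 * q))) ⟩
    suc (3 * q) * (r * r)   ≤⟨ *-monoˡ-≤ (r * r) 3q<κ ⟩
    κ * (r * r)             ∎))
    where open ≤-Reasoning

  fits : ∀ x t → x < R → x + κ * φ (3 * q) t < X
  fits x t x<R = begin-strict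
    x + κ * φ (3 * q) t   <⟨ +-mono-<-≤ x<R (*-monoʳ-≤ κ (<⇒≤ (φ-<-R t))) ⟩
    suc κ * R             ≤⟨ *-monoˡ-≤ R (+-monoˡ-≤ κ (<⇒≤ (<⇒≤ 2<κ))) ⟩
    (κ + κ) * R           ≡⟨ cong (λ n → (κ + n) * R) (+-identityʳ κ) ⟨
    2 * κ * R             ≤⟨ *-monoˡ-≤ R (*-monoˡ-≤ κ (<⇒≤ 2<κ)) ⟩
    κ * κ * R             ∎
    where open ≤-Reasoning

  -- Chains have `κ` sites, matching `k`, and `κ * κ` blocks suffice for the `2 * κ` crossings since
  -- `κ` exceeds 2.
  open Family κ s L R (κ * κ) X (φ (3 * q)) (φ-convex (3 * q)) (≤-reflexive (sym L≡)) (*-monoʳ-< κ 2<κ) fits public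

  order-power : Power order (orderExp q)
  order-power = power-* (power-* κ-power κ-power) (power-* (subst (λ a → Power a 1) (sym L≡) κ-power) (power-* X-power (power-* X-power s-power)))

  Q-power : Power Q (pathsExp q)
  Q-power = power-* R-power (power-* R-power (power-* s-power s-power))

  κ≤order : κ ≤ order
  κ≤order = begin
    κ                ≡⟨ ^-identityʳ κ ⟨
    κ ^ 1            ≤⟨ ^-monoʳ-≤ κ {1} {orderExp q} (s≤s z≤n) ⟩
    κ ^ orderExp q   ≡⟨ power-≡ order-power ⟨
    order            ∎
    where open ≤-Reasoning

  -- The exponent of the error is chosen as 1 over `orderExp q`, so the permitted error is exactly
  -- `κ`.
  error-small : ∀ e → e ^ orderExp q ≤ order ^ 1 → e < 2 * κ
  error-small e e^≤ = ≰⇒> λ 2κ≤e → <-irrefl refl (begin-strict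
    κ ^ orderExp q   <⟨ ^-monoˡ-< (orderExp q) (<-≤-trans (m<m*n κ 2 ≤-refl) (≤-trans (≤-reflexive (*-comm κ 2)) 2κ≤e)) ⟩
    e ^ orderExp q   ≤⟨ e^≤ ⟩
    order ^ 1        ≡⟨ ^-identityʳ order ⟩
    order            ≡⟨ power-≡ order-power ⟩
    κ ^ orderExp q   ∎)
    where open ≤-Reasoning

  bound-too-small : C ^ (3 * q) * order ^ (4 * q) < Q ^ (3 * q) * order ^ (3 * p)
  bound-too-small = begin-strict
    C ^ (3 * q) * order ^ (4 * q)                    ≡⟨ cong (C ^ (3 * q) *_) (power-≡ (power-^ (4 * q) order-power)) ⟩
    C ^ (3 * q) * κ ^ (orderExp q * (4 * q))         <⟨ *-monoˡ-< (κ ^ (orderExp q * (4 * q))) {{m^n≢0 κ (orderExp q * (4 * q))}} (^-monoˡ-< (3 * q) C<κ) ⟩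
    κ ^ (3 * q) * κ ^ (orderExp q * (4 * q))         ≡⟨ ^-distribˡ-+-* κ (3 * q) (orderExp q * (4 * q)) ⟨
    κ ^ (3 * q + orderExp q * (4 * q))               ≤⟨ ^-monoʳ-≤ κ (exponent-gap q) ⟩
    κ ^ (pathsExp q * (3 * q) + orderExp q * 3)      ≤⟨ ^-monoʳ-≤ κ (+-monoʳ-≤ (pathsExp q * (3 * q)) (*-monoʳ-≤ (orderExp q) (*-monoʳ-≤ 3 0<p))) ⟩
    κ ^ (pathsExp q * (3 * q) + orderExp q * (3 * p)) ≡⟨ power-≡ (power-* (power-^ (3 * q) Q-power) (power-^ (3 * p) order-power)) ⟨
    Q ^ (3 * q) * order ^ (3 * p)                    ∎
    where open ≤-Reasoning

theorem2 : (p q : ℕ) → 0 < p → 0 < q →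
    ∃[ a ] ∃[ b ] (0 < a × 0 < b × ¬ DistanceSketch p q a b)
theorem2 p q 0<p 0<q = 1 , orderExp q , s≤s z≤n , s≤s z≤n , no-sketch
  where
  no-sketch : ¬ DistanceSketch p q 1 (orderExp q)
  no-sketch (C , N₀ , ψ , dec , short , good) = no-short-injection Q (λ N → ψ order (member N))
    (sketch-injective (ψ order) (dec order) error-small (good order))
    (λ N → ≰⇒> λ Q≤ → <-irrefl refl (<-≤-trans bound-too-small
      (≤-trans (*-monoˡ-≤ (order ^ (3 * p)) (^-monoˡ-≤ (3 * q) Q≤)) (short order (≤-trans N₀≤κ κ≤order) (member N)))))
    where
    L κ : ℕ
    -- Large enough for `κ` to exceed 2, `C` and `3 * q`, and for the order to reach `N₀`.
    L = 2 + (C + (N₀ + 3 * q))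
    κ = suc L
    C≤ : C ≤ L
    C≤ = m≤n⇒m≤o+n 2 (m≤m+n C _)
    N₀≤κ : N₀ ≤ κ
    N₀≤κ = m≤n⇒m≤o+n 3 (m≤n⇒m≤o+n C (m≤m+n N₀ _))
    3q≤ : 3 * q ≤ L
    3q≤ = m≤n⇒m≤o+n 2 (m≤n⇒m≤o+n C (m≤n+m _ N₀))
    open Parameters p q κ L C 0<p 0<q refl (s≤s (s≤s (s≤s z≤n))) (s≤s C≤) (s≤s 3q≤)
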